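{- Let $a_1(n),a_2(n),a_3(n),m(n)$ be integer-valued quasi-polynomials with positive leading coefficients. Let $$d_0(n)=\mathrm{ggcd}(a_1(n),a_2(n),a_3(n)),\qquad m'(n)=\frac{m(n)}{d_0(n)},\qquad a_i'(n)=\frac{a_i(n)}{d_0(n)}\ (i=1,2,3),\qquad d(n)=\mathrm{ggcd}(a_1'(n),a_2'(n)),$$ $$x_0=\bigg\{\frac{m'(n)a_3'(n)^{ -1}}{d(n)}\bigg\}d(n),\qquad \widetilde{m'(n)}=\frac{m'(n)-a_3'(n)x_0}{d(n)},\qquad \widetilde{a_i'(n)}=\frac{a_i'(n)}{d(n)}\ (i=1,2),$$ where $a_3'(n)^{ -1}$ is an inverse of $a_3'(n)$ mod $d(n)$. Let $\chi(m(n),d_0(n))=1$ if $d_0(n)\mid m(n)$ and $0$ otherwise. Write $m,a_1,a_2,a_3$ for $\widetilde{m'(n)},\widetilde{a_1'(n)},\widetilde{a_2'(n)},a_3'(n)$ respectively, let $a_1^{ -1}$ be an inverse of $a_1=\widetilde{a_1'(n)}$ mod $a_2=\widetilde{a_2'(n)}$, and let $a_2^{ -1}$ be an inverse of $a_2$ mod $a_1$. Then, for all sufficiently large $n\in\mathbb{N}$, $$p_{\{a_1(n),a_2(n),a_3(n)\}}(m(n))=\chi(m(n),d_0(n))\bigg(C-\frac{1}{a_2}S\Big(0,\Big[\frac{m}{a_3}\Big],ma_1^{ -1};-a_3a_1^{ -1},a_2\Big)-\frac{1}{a_1}S\Big(0,\Big[\frac{m}{a_3}\Big],ma_2^{ -1};-a_3a_2^{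 -1},a_1\Big)\bigg),$$ where $$C=\sum_{x=0}^{[\frac{m}{a_3}]}\bigg(\frac{m-a_3x}{a_1a_2}+1\bigg).$$ (The right-hand side is read as $0$ when $\chi(m(n),d_0(n))=0$.)
   Context: $\mathbb{N}=\{0,1,2,\dots\}$; for rational $y$, $[y]$ is the floor and $\{y\}=y-[y]$ is the fractional part. For integers $r_1,\dots,r_5$ with $r_5\ne0$, $$S(r_1,r_2,r_3;r_4,r_5)=\sum_{x=r_1}^{r_2}\Big\{\frac{r_3+r_4x}{r_5}\Big\}r_5;$$ in the claim it is evaluated pointwise in $n$. A sum $\sum_{x=0}^{K}$ with $K<0$ is $0$. An integer-valued quasi-polynomial is a function $f:\mathbb{N}\to\mathbb{Z}$ for which there exist positive integers $T,C$ and polynomials $f_i(x)\in\mathbb{Z}[x]$ ($0\le i\le T-1$) such that $f(n)=f_i(m)$ whenever $n>C$, $n=Tm+i$, $m\in\mathbb{N}$. These form a commutative ring $R$ under pointwise operations; identities in $R$ are understood for all sufficiently large $n$. We say $f$ has positive leading coefficients if all $f_i$ are nonzero with positive leading coefficient, and we write $f\succcurlyeq 0$ if each $f_i$ is zero or has positive leading coefficient (equivalently $f(n)\ge0$ for all large $n$). For $f,g\in R$, $g\mid f$ in $R$ means $g(n)\neq0$ and $g(n)$ divides $f(n)$ in $\mathbb{Z}$, for all sufficiently large $n$. For $f_1,\dots,f_s\in R$, $\mathrm{ggcd}(f_1,\dots,f_s)$ is the greatest common divisor $d\in R$ with $d\succcurlyeq0$: $d\mid f_k$ for all $k$, and every $p\in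 R$ with $p\mid f_k$ for all $k$ satisfies $p\mid d$. If $\mathrm{ggcd}(b_1,b_2)=1$, there exist $u_1,u_2\in R$ with $b_1u_1+b_2u_2=1$; for any such pair, $u_1$ is called an inverse of $b_1$ mod $b_2$ (denoted $b_1^{ -1}$) and $u_2$ an inverse of $b_2$ mod $b_1$ (denoted $b_2^{ -1}$). The condition $d_0(n)\mid m(n)$ in the definition of $\chi$ is ordinary divisibility of integers at the given $n$. For positive integers $b_1,b_2,b_3$ and an integer $t$, $p_{\{b_1,b_2,b_3\}}(t)=\#\{(x_1,x_2,x_3)\in\mathbb{Z}^3:\text{ all }x_j\ge0,\ x_1b_1+x_2b_2+x_3b_3=t\}$. -}

module Defs where

open import Data.Nat.Base as ℕ using (ℕ; zero; suc)
open import Data.Integer.Base as ℤ using (ℤ; +_; +[1+_]; -[1+_]; 0ℤ; 1ℤ)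
import Data.Integer.Properties as ℤ
open import Data.Integer.Divisibility.Signed using (_∣_; _∣?_; divides)
open import Data.Rational.Base as ℚ using (ℚ; 0ℚ; 1ℚ; floor; *≡*)
open import Data.Rational.Unnormalised.Base as ℚᵘ using (mkℚᵘ)
import Data.Rational.Unnormalised.Properties as ℚᵘ
import Data.Rational.Properties as ℚ
import Data.Nat.DivMod as ℕ
import Data.Nat.Properties as ℕ
open import Data.Nat.Coprimality using (sym; 1-coprimeTo)
open import Data.Fin.Base using (Fin; toℕ)
open import Data.List.Base using (List; []; _∷_; foldr; applyUpTo)
open import Data.List.Relation.Unary.All using (All)
open import Data.Product.Base using (Σ-syntax; ∃-syntax; _×_; _,_)
open import Data.Sum.Base using (_⊎_)
open import Data.Bool.Base using (if_then_else_)
open import Algebra.Properties.Group ℚ.+-0-group using (⁻¹-involutive)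
open import Function.Bundles using (_↔_)
open import Relation.Nullary.Decidable.Core using (does)
open import Relation.Nullary.Negation.Core using (contradiction)
open import Relation.Binary.PropositionalEquality
  using (_≡_; _≢_; refl; cong; cong₂; trans; module ≡-Reasoning)
  renaming (sym to ≡-sym)

Eventually : (ℕ → Set) → Set
Eventually P = ∃[ N ] (∀ n → N ℕ.≤ n → P n)

------------------------------------------------------------------------
-- ℤ[x]: coefficient lists, constant term first, trailing zeros allowed.

Poly : Set
Poly = List ℤ

coeff : Poly → ℕ → ℤ
coeff []      _       = 0ℤ
coeff (c ∷ _) zero    = c
coeff (_ ∷ p) (suc k) = coeff p k

eval : Poly → ℤ → ℤ
eval p x = foldr (λ c v → c ℤ.+ x ℤ.* v) 0ℤ p

IsZero : Poly → Set
IsZero p = ∀ k → coeff p k ≡ 0ℤ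

HasPositiveLeadingCoeff : Poly → Set
HasPositiveLeadingCoeff p =
  ∃[ k ] (0ℤ ℤ.< coeff p k × (∀ j → k ℕ.< j → coeff p j ≡ 0ℤ))

------------------------------------------------------------------------
-- Integer-valued quasi-polynomials.  The ring R consists of the
-- functions satisfying IsQuasiPolynomial, up to eventual equality.

record IsQuasiPolynomial (f : ℕ → ℤ) : Set where
  field
    T C         : ℕ
    0<T         : 0 ℕ.< T
    0<C         : 0 ℕ.< C
    constituent : Fin T → Poly
    agrees      : ∀ i m → C ℕ.< T ℕ.* m ℕ.+ toℕ i →
                  f (T ℕ.* m ℕ.+ toℕ i) ≡ eval (constituent i) (+ m)

open IsQuasiPolynomial public using (constituent)

-- The sign of the leading coefficients does not depend on the chosen
-- period and constituents: they are determined by infinitely many values.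
HasPositiveLeadingCoeffs : (ℕ → ℤ) → Set
HasPositiveLeadingCoeffs f =
  Σ[ q ∈ IsQuasiPolynomial f ]
    (∀ i → HasPositiveLeadingCoeff (constituent q i))

infix 4 _≽0
_≽0 : (ℕ → ℤ) → Set
f ≽0 =
  Σ[ q ∈ IsQuasiPolynomial f ]
    (∀ i → IsZero (constituent q i) ⊎ HasPositiveLeadingCoeff (constituent q i))

infix 4 _∣ᴿ_
_∣ᴿ_ : (ℕ → ℤ) → (ℕ → ℤ) → Set
g ∣ᴿ f = Eventually λ n → g n ≢ 0ℤ × g n ∣ f n

record IsGGCD (d : ℕ → ℤ) (fs : List (ℕ → ℤ)) : Set where
  field
    quasiPolynomial : IsQuasiPolynomial d
    nonNegative     : d ≽0
    common          : All (d ∣ᴿ_) fs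
    greatest        : ∀ p → IsQuasiPolynomial p → All (p ∣ᴿ_) fs → p ∣ᴿ d

-- u is an inverse of b₁ mod b₂; this identity forces ggcd(b₁, b₂) = 1.
IsInverse : (u b₁ b₂ : ℕ → ℤ) → Set
IsInverse u b₁ b₂ =
  IsQuasiPolynomial u ×
  ∃[ v ] (IsQuasiPolynomial v ×
          Eventually λ n → b₁ n ℤ.* u n ℤ.+ b₂ n ℤ.* v n ≡ 1ℤ)

------------------------------------------------------------------------
-- Rational arithmetic.

ι : ℤ → ℚ
ι z = z ℚ./ 1

-- The quotient a/b, with value 0 if b = 0.
infixl 7 _/ℚ_
_/ℚ_ : ℤ → ℤ → ℚ
a /ℚ (+ zero) = 0ℚ
a /ℚ +[1+ n ] = a ℚ./ suc n
a /ℚ -[1+ n ] = (ℤ.- a) ℚ./ suc n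

-- Not the library's fracPart, which truncates towards 0 and takes an
-- absolute value, so that it differs from y − ⌊y⌋ for negative y.
frac : ℚ → ℚ
frac y = y ℚ.- ι (floor y)

-- The quotient of integers as an integer; exact when b ∣ a (÷-exact).
infixl 7 _÷_
_÷_ : ℤ → ℤ → ℤ
a ÷ b = floor (a /ℚ b)

-- {a/d}·d, which is an integer (residue-exact).
residue : ℤ → ℤ → ℤ
residue a d = floor (frac (a /ℚ d) ℚ.* ι d)

-- The sum over integers r₁ ≤ x ≤ r₂, empty if r₂ < r₁.
∑ : (r₁ r₂ : ℤ) → (ℤ → ℚ) → ℚ
∑ r₁ r₂ f = foldr ℚ._+_ 0ℚ (applyUpTo (λ j → f (r₁ ℤ.+ + j)) (terms (ℤ.suc (r₂ ℤ.- r₁))))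
  where
  terms : ℤ → ℕ
  terms (+ k)    = k
  terms -[1+ _ ] = 0

S : (r₁ r₂ r₃ r₄ r₅ : ℤ) → ℚ
S r₁ r₂ r₃ r₄ r₅ = ∑ r₁ r₂ λ x → frac ((r₃ ℤ.+ r₄ ℤ.* x) /ℚ r₅) ℚ.* ι r₅

χ : ℤ → ℤ → ℚ
χ m d₀ = if does (d₀ ∣? m) then 1ℚ else 0ℚ

------------------------------------------------------------------------

record Solution (b₁ b₂ b₃ t : ℤ) : Set where
  field
    x₁ x₂ x₃ : ℤ
    0≤x₁     : 0ℤ ℤ.≤ x₁
    0≤x₂     : 0ℤ ℤ.≤ x₂
    0≤x₃     : 0ℤ ℤ.≤ x₃
    sum      : x₁ ℤ.* b₁ ℤ.+ x₂ ℤ.* b₂ ℤ.+ x₃ ℤ.* b₃ ≡ t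

-- The value of p_{b₁,b₂,b₃}(t) is k.
p[_,_,_]⟨_⟩≔_ : (b₁ b₂ b₃ t : ℤ) → ℕ → Set
p[ b₁ , b₂ , b₃ ]⟨ t ⟩≔ k = Fin k ↔ Solution b₁ b₂ b₃ t

------------------------------------------------------------------------
-- The floors in _÷_ and residue do not round.

ι-canonical : ∀ z → ι z ≡ ℚ.mkℚ z 0 (sym (1-coprimeTo ℤ.∣ z ∣))
ι-canonical z = ℚ.↥p/↧p≡p (ℚ.mkℚ z 0 (sym (1-coprimeTo ℤ.∣ z ∣)))

/ℕ1 : ∀ z → z ℤ./ℕ 1 ≡ z
/ℕ1 (+ n)    = cong +_ (ℕ.n/1≡n n)
/ℕ1 -[1+ n ] with suc n ℕ.% 1 in eq
... | zero  = cong (λ k → ℤ.- (+ k)) (ℕ.n/1≡n (suc n))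
... | suc _ = contradiction (trans (≡-sym eq) (ℕ.n%1≡0 (suc n))) λ ()

floor-ι : ∀ z → floor (ι z) ≡ z
floor-ι z = trans (cong floor (ι-canonical z))
                  (trans (ℤ.*-identityˡ (z ℤ./ℕ 1)) (/ℕ1 z))

*-/ℚ-cancel : ∀ q b → b ≢ 0ℤ → (q ℤ.* b) /ℚ b ≡ ι q
*-/ℚ-cancel q (+ zero) b≢0 = contradiction refl b≢0
*-/ℚ-cancel q +[1+ n ] _ =
  ℚ.fromℚᵘ-cong {mkℚᵘ (q ℤ.* +[1+ n ]) n} {mkℚᵘ q 0}
    (ℚᵘ.*≡* (ℤ.*-identityʳ (q ℤ.* +[1+ n ])))
*-/ℚ-cancel q -[1+ n ] _ = trans
  (cong (λ z → z ℚ./ suc n) (ℤ.neg-distribʳ-* q -[1+ n ]))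
  (*-/ℚ-cancel q +[1+ n ] λ ())

÷-exact : ∀ a b → b ≢ 0ℤ → b ∣ a → a ÷ b ℤ.* b ≡ a
÷-exact _ b b≢0 (divides q refl) =
  cong (ℤ._* b) (trans (cong floor (*-/ℚ-cancel q b b≢0)) (floor-ι q))

ι-* : ∀ a b → ι a ℚ.* ι b ≡ ι (a ℤ.* b)
ι-* a b = cong₂ ℚ._*_ (ι-canonical a) (ι-canonical b)

ι-+ : ∀ a b → ι a ℚ.+ ι b ≡ ι (a ℤ.+ b)
ι-+ a b = trans (cong₂ ℚ._+_ (ι-canonical a) (ι-canonical b))
  (cong ι (cong₂ ℤ._+_ (ℤ.*-identityʳ a) (ℤ.*-identityʳ b)))

neg-ι : ∀ z → ℚ.- ι z ≡ ι (ℤ.- z)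
neg-ι (+ zero) = refl
neg-ι +[1+ k ] = refl
neg-ι -[1+ k ] = ⁻¹-involutive (ι +[1+ k ])

/ℚ-* : ∀ a d → d ≢ 0ℤ → a /ℚ d ℚ.* ι d ≡ ι a
/ℚ-* a (+ zero) d≢0 = contradiction refl d≢0
/ℚ-* a +[1+ n ] _ = ℚ.toℚᵘ-injective (begin
  ℚ.toℚᵘ (a ℚ./ suc n ℚ.* ι +[1+ n ])
    ≈⟨ ℚ.toℚᵘ-homo-* (a ℚ./ suc n) (ι +[1+ n ]) ⟩
  ℚ.toℚᵘ (a ℚ./ suc n) ℚᵘ.* ℚ.toℚᵘ (ι +[1+ n ])
    ≈⟨ ℚᵘ.*-cong (ℚ.toℚᵘ-fromℚᵘ (mkℚᵘ a n)) (ℚ.toℚᵘ-fromℚᵘ (mkℚᵘ +[1+ n ] 0)) ⟩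
  mkℚᵘ a n ℚᵘ.* mkℚᵘ +[1+ n ] 0
    ≈⟨ ℚᵘ.*≡* (trans (ℤ.*-identityʳ (a ℤ.* +[1+ n ]))
                     (cong (λ k → a ℤ.* + k) (≡-sym (ℕ.*-identityʳ (suc n))))) ⟩
  mkℚᵘ a 0
    ≈⟨ ℚ.toℚᵘ-fromℚᵘ (mkℚᵘ a 0) ⟨
  ℚ.toℚᵘ (ι a) ∎)
  where open import Relation.Binary.Reasoning.Setoid ℚᵘ.≃-setoid
/ℚ-* a -[1+ n ] _ = begin
  (ℤ.- a) ℚ./ suc n ℚ.* ι -[1+ n ]      ≡⟨⟩
  (ℤ.- a) ℚ./ suc n ℚ.* ℚ.- ι +[1+ n ]  ≡⟨ ℚ.neg-distribʳ-* ((ℤ.- a) ℚ./ suc n) (ι +[1+ n ]) ⟨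
  ℚ.- ((ℤ.- a) ℚ./ suc n ℚ.* ι +[1+ n ]) ≡⟨ cong ℚ.-_ (/ℚ-* (ℤ.- a) +[1+ n ] λ ()) ⟩
  ℚ.- ι (ℤ.- a)                         ≡⟨ neg-ι (ℤ.- a) ⟩
  ι (ℤ.- (ℤ.- a))                       ≡⟨ cong ι (ℤ.neg-involutive a) ⟩
  ι a                                   ∎
  where
  open ≡-Reasoning

residue-exact : ∀ a d → d ≢ 0ℤ → ι (residue a d) ≡ frac (a /ℚ d) ℚ.* ι d
residue-exact a d d≢0 =
  trans (cong (λ y → ι (floor y)) integral)
        (trans (cong ι (floor-ι r)) (≡-sym integral))
  where
  open ≡-Reasoning
  y = a /ℚ d
  r = a ℤ.+ (ℤ.- floor y) ℤ.* d
  integral : frac y ℚ.* ι d ≡ ι r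
  integral = begin
    (y ℚ.- ι (floor y)) ℚ.* ι d               ≡⟨ ℚ.*-distribʳ-+ (ι d) y (ℚ.- ι (floor y)) ⟩
    y ℚ.* ι d ℚ.+ (ℚ.- ι (floor y)) ℚ.* ι d   ≡⟨ cong₂ ℚ._+_ (/ℚ-* a d d≢0) (cong (ℚ._* ι d) (neg-ι (floor y))) ⟩
    ι a ℚ.+ ι (ℤ.- floor y) ℚ.* ι d           ≡⟨ cong (ι a ℚ.+_) (ι-* (ℤ.- floor y) d) ⟩
    ι a ℚ.+ ι ((ℤ.- floor y) ℤ.* d)           ≡⟨ ι-+ a ((ℤ.- floor y) ℤ.* d) ⟩
    ι r                                       ∎

{-# OPTIONS --safe #-}

-- For large n all of a₁, a₂, a₃, d₀, d are positive.  If d₀ ∣ m, the solutions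
-- are those of x₁ a₁′ + x₂ a₂′ + x₃ a₃′ = m′, where x₃ ≡ x₀ mod d; writing
-- x₃ = x₀ + d i turns the equation into x₁ A₁ + x₂ A₂ = m̃ − a₃′ i, with i
-- running over 0 ≤ i ≤ [m̃/a₃′].  The solutions of x₁ a + x₂ b = t with
-- aI ≡ 1 mod b and bJ ≡ 1 mod a are counted by Popoviciu's formula: with r, s
-- the residues of tI mod b and tJ mod a, every solution is
-- (r + b j , s + a l), and t − ar − bs = ab (q − 1) where j + l + 1 = q, so
-- there are q = t/(ab) − r/b − s/a + 1 of them.

module Submission where

open import Defs
open import Data.Nat.Base using (ℕ)
open import Data.Integer.Base using (ℤ; +_; 0ℤ; -_; _+_; _-_; _*_)
open import Data.Rational.Base as ℚ using (ℚ; 1ℚ; floor)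
open import Data.List.Base using ([]; _∷_)
open import Data.Product.Base using (∃-syntax; _×_)
open import Relation.Binary.PropositionalEquality using (_≡_)
open import Data.Nat.Base as ℕ using (zero; suc; z≤n; s≤s)
import Data.Nat.DivMod as ℕ
import Data.Nat.Properties as ℕ
open import Data.Nat.ListAction using (sum)
open import Data.Integer.Base using
  (+[1+_]; -[1+_]; 1ℤ; _≤_; _<_; positive; nonNegative; ∣_∣; >-nonZero; +≤+; +<+)
import Data.Integer.DivMod as ℤ
import Data.Integer.Properties as ℤ
open import Data.Integer.Divisibility.Signed using (_∣_; _∣?_; divides; ∣m∣n⇒∣m+n; ∣n⇒∣m*n)
open import Data.Integer.GCD using (gcd)
open import Data.Integer.Tactic.RingSolver using (solve-∀)
open import Data.Rational.Base using (0ℚ; ↥_; ↧_)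
import Data.Rational.Properties as ℚ
import Data.Rational.Solver as ℚ
open import Data.Bool.Base using (if_then_else_)
open import Data.Fin.Base using (Fin; zero; suc; toℕ; fromℕ<; opposite)
open import Data.Fin.Properties using (toℕ<n; toℕ-fromℕ<; toℕ-injective; opposite-prop; +↔⊎)
open import Data.List.Base using (applyUpTo; foldr)
open import Data.List.Relation.Unary.All using (_∷_)
open import Data.Product.Base using (Σ-syntax; _,_; proj₁; proj₂)
open import Data.Sum.Base using (_⊎_; inj₁; inj₂)
open import Data.Sum.Function.Propositional using (_⊎-↔_)
open import Algebra.Properties.AbelianGroup ℤ.+-0-abelianGroup using (∙-cancelˡ)
open import Function.Base using (_∘_)
open import Function.Bundles using (_↔_; mk↔ₛ′; mk⤖)
open import Function.Construct.Composition using (_↔-∘_)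
open import Function.Construct.Identity using (↔-id)
open import Function.Properties.Bijection using (⤖⇒↔)
open import Relation.Nullary.Decidable using (Dec; yes; no; dec-true; dec-false)
open import Relation.Nullary.Negation.Core using (¬_; contradiction)
open import Relation.Binary.PropositionalEquality using
  (_≢_; refl; sym; trans; cong; cong₂; subst; subst₂; module ≡-Reasoning)

-- Signs and linear identities in the integers.

pos*nonNeg : ∀ {i j} → 0ℤ < i → 0ℤ ≤ j → 0ℤ ≤ i * j
pos*nonNeg {i} {j} 0<i 0≤j =
  subst (_≤ i * j) (ℤ.*-zeroʳ i) (ℤ.*-monoˡ-≤-nonNeg i 0≤j)
  where instance _ = nonNegative (ℤ.<⇒≤ 0<i)

pos*pos : ∀ {i j} → 0ℤ < i → 0ℤ < j → 0ℤ < i * j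
pos*pos {i} {j} 0<i 0<j = subst (_< i * j) (ℤ.*-zeroʳ i) (ℤ.*-monoˡ-<-pos i 0<j)
  where instance _ = positive 0<i

pos*-cancel : ∀ {i j} → 0ℤ < i → 0ℤ < i * j → 0ℤ < j
pos*-cancel {i} {j} 0<i 0<ij =
  ℤ.*-cancelˡ-<-nonNeg i (subst (_< i * j) (sym (ℤ.*-zeroʳ i)) 0<ij)
  where instance _ = nonNegative (ℤ.<⇒≤ 0<i)

i<j⇒0<j-i : ∀ {i j} → i < j → 0ℤ < j - i
i<j⇒0<j-i {i} {j} i<j = subst (_< j - i) (ℤ.+-inverseʳ i) (ℤ.+-monoˡ-< (- i) i<j)

0<1+i⇒0≤i : ∀ {i} → 0ℤ < 1ℤ + i → 0ℤ ≤ i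
0<1+i⇒0≤i {i} 0<1+i = subst (0ℤ ≤_) (ℤ.pred-suc i) (ℤ.i<j⇒i≤pred[j] 0<1+i)

-- Reduces x ≡ y to a ring identity: x − y is formally a multiple of l − r.
linear : ∀ {x y l r} c → l ≡ r → x ≡ y + c * (l - r) → x ≡ y
linear {y = y} {r = r} c refl x≡ = trans x≡ (identity y c r)
  where
  identity : ∀ y c r → y + c * (r - r) ≡ y
  identity = solve-∀

-- Floors and remainders.

-- The integer `{a/d}·d`; for `d > 0` it is the representative of `a` mod `d` in the interval from 0
-- to `d - 1`.
floor-rem : ℤ → ℤ → ℤ
floor-rem a d = a - floor (a /ℚ d) * d

private
  -- `floor` divides the numerator of the fraction in lowest terms by its denominator. Scaling that
  -- division back by the gcd `g` of `a` and `suc n` gives the remainder for `a` and `suc n`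
  -- themselves.
  floor-rem-/ : ∀ a n → ∃[ r ] ∃[ g ] (0ℤ ≤ + r × + r < ↧ (a ℚ./ suc n) × 0ℤ < g
    × ↧ (a ℚ./ suc n) * g ≡ +[1+ n ] × floor-rem a +[1+ n ] ≡ + r * g)
  floor-rem-/ a n with a ℚ./ suc n | ℚ.↥-/ a (suc n) | ℚ.↧-/ a (suc n)
  ... | p@record{} | ↥g≡a | ↧g≡d =
    ↥ p ℤ.% ↧ p , gcd a +[1+ n ] , +≤+ z≤n , +<+ (ℤ.n%d<d (↥ p) (↧ p)) ,
    pos*-cancel {↧ p} (+<+ (s≤s z≤n)) (subst (0ℤ <_) (sym ↧g≡d) (+<+ (s≤s z≤n))) , ↧g≡d ,
    trans (cong₂ (λ x y → x - floor p * y) (sym ↥g≡a) (sym ↧g≡d))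
      (trans (regroup (↥ p) (gcd a +[1+ n ]) (floor p) (↧ p))
        (cong (_* gcd a +[1+ n ]) (trans (cong (_- floor p * ↧ p) (ℤ.a≡a%n+[a/n]*n (↥ p) (↧ p)))
          (cancel (+ (↥ p ℤ.% ↧ p)) (floor p * ↧ p)))))
    where
    regroup : ∀ x g f y → x * g - f * (y * g) ≡ (x - f * y) * g
    regroup = solve-∀
    cancel : ∀ x y → x + y - y ≡ x
    cancel = solve-∀

0≤floor-rem : ∀ a d → 0ℤ < d → 0ℤ ≤ floor-rem a d
0≤floor-rem a +[1+ n ] _ with floor-rem-/ a n
... | r , g , 0≤r , _ , 0<g , _ , eq =
  subst (0ℤ ≤_) (trans (ℤ.*-comm g (+ r)) (sym eq)) (pos*nonNeg 0<g 0≤r)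
0≤floor-rem a (+ zero) (+<+ ())

floor-rem<d : ∀ a d → 0ℤ < d → floor-rem a d < d
floor-rem<d a +[1+ n ] _ with floor-rem-/ a n
... | r , g , _ , r<↧ , 0<g , ↧g , eq =
  subst₂ _<_ (sym eq) ↧g (ℤ.*-monoʳ-<-pos g r<↧)
  where instance _ = positive 0<g
floor-rem<d a (+ zero) (+<+ ())

-- Here `d(1 + e) = x + (d - r)` is positive, hence so is `1 + e`. This makes the quotients left
-- after subtracting a residue natural numbers.
quotient-nonNeg : ∀ {x r d e} → 0ℤ < d → 0ℤ ≤ x → r < d → x ≡ r + d * e → 0ℤ ≤ e
quotient-nonNeg {x} {r} {d} {e} 0<d 0≤x r<d refl =
  0<1+i⇒0≤i (pos*-cancel 0<d (subst (0ℤ <_) (regroup r d e)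
    (ℤ.+-mono-≤-< 0≤x (i<j⇒0<j-i r<d))))
  where
  regroup : ∀ r d e → (r + d * e) + (d - r) ≡ d * (1ℤ + e)
  regroup = solve-∀

floor-adjoint : ∀ a d → 0ℤ < d → ∀ x → x ≤ floor (a /ℚ d) → d * x ≤ a
floor-adjoint a d 0<d x x≤f = ℤ.0≤i-j⇒j≤i (subst (0ℤ ≤_) (regroup a d x (floor (a /ℚ d)))
  (ℤ.+-mono-≤ (0≤floor-rem a d 0<d) (pos*nonNeg 0<d (ℤ.i≤j⇒0≤j-i x≤f))))
  where
  regroup : ∀ a d x f → (a - f * d) + d * (f - x) ≡ a - d * x
  regroup = solve-∀

floor-adjoint⁻¹ : ∀ a d → 0ℤ < d → ∀ x → d * x ≤ a → x ≤ floor (a /ℚ d)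
floor-adjoint⁻¹ a d 0<d x dx≤a = ℤ.0≤i-j⇒j≤i
  (quotient-nonNeg 0<d (ℤ.i≤j⇒0≤j-i dx≤a) (floor-rem<d a d 0<d) (regroup a d x (floor (a /ℚ d))))
  where
  regroup : ∀ a d x f → a - d * x ≡ (a - f * d) + d * (f - x)
  regroup = solve-∀

-- Popoviciu's count for two coprime coefficients.

module Popoviciu (a b I J v w : ℤ) (0<a : 0ℤ < a) (0<b : 0ℤ < b)
                 (aI+bv≡1 : a * I + b * v ≡ 1ℤ) (bJ+aw≡1 : b * J + a * w ≡ 1ℤ) where

  -- `q t` is `t/(ab) - r/b - s/a + 1` written without division, so that it is an integer by
  -- construction.
  r s q : ℤ → ℤ
  r t = floor-rem (t * I) b
  s t = floor-rem (t * J) a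
  q t = 1ℤ + (t * (v * w - I * J) + (floor ((t * I) /ℚ b) + floor ((t * J) /ℚ a)))

  -- (1 − aI)(1 − bJ) = ab·vw exhibits t − ar − bs as a multiple of ab.
  decompose : ∀ t → t + a * b ≡ a * r t + b * s t + a * b * q t
  decompose t = linear (t * (b * J - 1ℤ)) aI+bv≡1
    (linear (- (t * (b * v))) bJ+aw≡1
      (identity a b I J v w t (floor ((t * I) /ℚ b)) (floor ((t * J) /ℚ a))))
    where
    identity : ∀ a b I J v w t f g → t + a * b ≡
      a * (t * I - f * b) + b * (t * J - g * a) + a * b * (1ℤ + (t * (v * w - I * J) + (f + g)))
      + (t * (b * J - 1ℤ)) * (a * I + b * v - 1ℤ) + (- (t * (b * v))) * (b * J + a * w - 1ℤ)
    identity = solve-∀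

  -- Since `r < b` and `s < a`, the number `t + a(b - r) + b(a - s) = ab(1 + q)` is positive for
  -- `t ≥ 0`. The value 0 can occur.
  0≤q : ∀ {t} → 0ℤ ≤ t → 0ℤ ≤ q t
  0≤q {t} 0≤t = 0<1+i⇒0≤i (pos*-cancel (pos*pos 0<a 0<b) (subst (0ℤ <_)
    (linear 1ℤ (decompose t) (identity a b t (r t) (s t) (q t)))
    (ℤ.+-mono-≤-< 0≤t (ℤ.+-mono-< (pos*pos 0<a (i<j⇒0<j-i (floor-rem<d (t * I) b 0<b)))
                                  (pos*pos 0<b (i<j⇒0<j-i (floor-rem<d (t * J) a 0<a)))))))
    where
    identity : ∀ a b t r s q → t + (a * (b - r) + b * (a - s)) ≡
      a * b * (1ℤ + q) + 1ℤ * (t + a * b - (a * r + b * s + a * b * q))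
    identity = solve-∀

  represents : ∀ t j l → 1ℤ + (j + l) ≡ q t → a * (r t + b * j) + b * (s t + a * l) ≡ t
  represents t j l eq = linear (a * b) eq (linear (- 1ℤ) (decompose t)
    (identity a b t (r t) (s t) (q t) j l))
    where
    identity : ∀ a b t r s q j l → a * (r + b * j) + b * (s + a * l) ≡
      t + a * b * (1ℤ + (j + l) - q) + (- 1ℤ) * (t + a * b - (a * r + b * s + a * b * q))
    identity = solve-∀

  represented : ∀ {t x y} → 0ℤ ≤ x → 0ℤ ≤ y → a * x + b * y ≡ t →
    ∃[ j ] ∃[ l ] (x ≡ r t + b * + j × y ≡ s t + a * + l × 1ℤ + (+ j + + l) ≡ q t)
  represented {t} {x} {y} 0≤x 0≤y refl = ∣ j ∣ , ∣ l ∣ ,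
    trans x≡ (cong (λ z → r t + b * z) (sym +j)) , trans y≡ (cong (λ z → s t + a * z) (sym +l)) ,
    subst₂ (λ j l → 1ℤ + (j + l) ≡ q t) (sym +j) (sym +l)
      (ℤ.*-cancelˡ-≡ (a * b) _ _ {{>-nonZero (pos*pos 0<a 0<b)}}
        (linear (- a) x≡ (linear (- b) y≡ (linear 1ℤ (decompose t)
          (identity″ a b x y (r t) (s t) (q t) j l)))))
    where
    j l : ℤ
    -- With `t = ax + by` and `1 - aI = bv`, `x - tI = b(xv - yI)`; adding the floor turns `tI` into
    -- the residue `r t`. The formula for `l` is symmetric.
    j = x * v - y * I + floor ((t * I) /ℚ b)
    l = y * w - x * J + floor ((t * J) /ℚ a)
    identity : ∀ a b I v x y f → x ≡
      ((a * x + b * y) * I - f * b) + b * (x * v - y * I + f) + (- x) * (a * I + b * v - 1ℤ)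
    identity = solve-∀
    identity′ : ∀ a b J w x y g → y ≡
      ((a * x + b * y) * J - g * a) + a * (y * w - x * J + g) + (- y) * (b * J + a * w - 1ℤ)
    identity′ = solve-∀
    identity″ : ∀ a b x y r s q j l → a * b * (1ℤ + (j + l)) ≡
      a * b * q + (- a) * (x - (r + b * j)) + (- b) * (y - (s + a * l))
        + 1ℤ * (a * x + b * y + a * b - (a * r + b * s + a * b * q))
    identity″ = solve-∀
    x≡ : x ≡ r t + b * j
    x≡ = linear (- x) aI+bv≡1 (identity a b I v x y (floor ((t * I) /ℚ b)))
    y≡ : y ≡ s t + a * l
    y≡ = linear (- y) bJ+aw≡1 (identity′ a b J w x y (floor ((t * J) /ℚ a)))
    +j : + ∣ j ∣ ≡ j
    +j = ℤ.0≤i⇒+∣i∣≡i (quotient-nonNeg 0<b 0≤x (floor-rem<d (t * I) b 0<b) x≡)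
    +l : + ∣ l ∣ ≡ l
    +l = ℤ.0≤i⇒+∣i∣≡i (quotient-nonNeg 0<a 0≤y (floor-rem<d (t * J) a 0<a) y≡)

-- Finite enumerations and equality of solutions.

Fin-sum : ∀ (N : ℕ → ℕ) k → Fin (sum (applyUpTo N k)) ↔ (Σ[ i ∈ Fin k ] Fin (N (toℕ i)))
Fin-sum N zero    = mk↔ₛ′ (λ ()) (λ ()) (λ ()) (λ ())
Fin-sum N (suc k) = Σ-suc ↔-∘ ((↔-id _ ⊎-↔ Fin-sum (N ∘ suc) k) ↔-∘ +↔⊎)
  where
  Σ-suc : (Fin (N 0) ⊎ (Σ[ i ∈ Fin k ] Fin (N (suc (toℕ i))))) ↔
          (Σ[ i ∈ Fin (suc k) ] Fin (N (toℕ i)))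
  Σ-suc = mk↔ₛ′
    (λ { (inj₁ j) → zero , j ; (inj₂ (i , j)) → suc i , j })
    (λ { (zero , j) → inj₁ j ; (suc i , j) → inj₂ (i , j) })
    (λ { (zero , j) → refl ; (suc i , j) → refl })
    (λ { (inj₁ j) → refl ; (inj₂ (i , j)) → refl })

-- The pairs of naturals with `1 + j + l = n` are enumerated by `Fin n` through `toℕ i` and
-- `toℕ (opposite i)`; this also covers `n = 0`, where there are none. So `Fin (q t)` indexes the
-- pairs `(j , l)` of Popoviciu's formula.
toℕ+opposite : ∀ {n} (i : Fin n) → suc (toℕ i ℕ.+ toℕ (opposite i)) ≡ n
toℕ+opposite i = trans (cong (λ z → suc (toℕ i ℕ.+ z)) (opposite-prop i)) (ℕ.m+[n∸m]≡n (toℕ<n i))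

split-Fin : ∀ {n} j l → suc (j ℕ.+ l) ≡ n → ∃[ i ] (toℕ {n} i ≡ j × toℕ (opposite i) ≡ l)
split-Fin {n} j l refl = i , toℕ-fromℕ< j<n ,
  ℕ.+-cancelˡ-≡ (suc j) _ _ (trans (cong (λ z → suc z ℕ.+ toℕ (opposite i)) (sym (toℕ-fromℕ< j<n)))
    (toℕ+opposite i))
  where
  j<n = s≤s (ℕ.m≤m+n j l)
  i = fromℕ< j<n

-- Proofs of `≤` are irrelevant and proofs of equations in ℤ are unique, so only the coordinates
-- matter.
solution-≡ : ∀ {b₁ b₂ b₃ t} {x y : Solution b₁ b₂ b₃ t} → let open Solution in
  x₁ x ≡ x₁ y → x₂ x ≡ x₂ y → x₃ x ≡ x₃ y → x ≡ y
solution-≡ {x = record { 0≤x₁ = p₁ ; 0≤x₂ = p₂ ; 0≤x₃ = p₃ ; sum = refl }}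
           {y = record { 0≤x₁ = q₁ ; 0≤x₂ = q₂ ; 0≤x₃ = q₃ ; sum = refl }} refl refl refl
  with refl ← ℤ.≤-irrelevant p₁ q₁ | refl ← ℤ.≤-irrelevant p₂ q₂
     | refl ← ℤ.≤-irrelevant p₃ q₃ = refl

+-*-injective : ∀ {r a x y} → 0ℤ < a → r + a * + x ≡ r + a * + y → x ≡ y
+-*-injective {r} {a} 0<a eq =
  ℤ.+-injective (ℤ.*-cancelˡ-≡ a _ _ {{>-nonZero 0<a}} (∙-cancelˡ r _ _ eq))

Fin-pair-≡ : ∀ {k} (N : ℕ → ℕ) {i i′ : Fin k} {j : Fin (N (toℕ i))} {j′ : Fin (N (toℕ i′))} →
  i ≡ i′ → toℕ j ≡ toℕ j′ → (i , j) ≡ (i′ , j′)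
Fin-pair-≡ N {i} refl eq = cong (i ,_) (toℕ-injective eq)

-- From three variables to a sum of two-variable counts.

module Reduction
  {A₁ A₂ A₃ d d₀ a₁ a₂ a₃ m : ℤ} (M : ℤ) (I₁ v₁ I₂ v₂ m′ I₃ v₃ : ℤ)
  (0<A₁ : 0ℤ < A₁) (0<A₂ : 0ℤ < A₂) (0<A₃ : 0ℤ < A₃) (0<d : 0ℤ < d) (0<d₀ : 0ℤ < d₀)
  (inverse₁ : A₁ * I₁ + A₂ * v₁ ≡ 1ℤ) (inverse₂ : A₂ * I₂ + A₁ * v₂ ≡ 1ℤ)
  (inverse₃ : A₃ * I₃ + d * v₃ ≡ 1ℤ)
  (a₁≡ : a₁ ≡ A₁ * d * d₀) (a₂≡ : a₂ ≡ A₂ * d * d₀) (a₃≡ : a₃ ≡ A₃ * d₀)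
  (m≡ : m ≡ m′ * d₀) (m′≡ : m′ ≡ M * d + A₃ * floor-rem (m′ * I₃) d)
  -- The two conditions make `k` the number of naturals `i` with `A₃ i ≤ M`; it is 0 when `M` is
  -- negative.
  (k : ℕ) (below : ∀ {i} → i ℕ.< k → A₃ * + i ≤ M) (below⁻¹ : ∀ {i} → A₃ * + i ≤ M → i ℕ.< k)
  where

  open Popoviciu A₁ A₂ I₁ I₂ v₁ v₂ 0<A₁ 0<A₂ inverse₁ inverse₂ public

  x₀ : ℤ
  x₀ = floor-rem (m′ * I₃) d

  t : ℕ → ℤ
  t i = M - A₃ * + i

  -- For `i < k` the argument `t i` is nonnegative, so by `0≤q` the absolute value changes nothing
  -- at the indices that are summed.
  N : ℕ → ℕ
  N i = ∣ q (t i) ∣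

  +N≡q : ∀ {i} → i ℕ.< k → + N i ≡ q (t i)
  +N≡q i<k = ℤ.0≤i⇒+∣i∣≡i (0≤q (ℤ.i≤j⇒0≤j-i (below i<k)))

  solution : (Σ[ i ∈ Fin k ] Fin (N (toℕ i))) → Solution a₁ a₂ a₃ m
  solution (i , j) = record
    { x₁ = r tᵢ + A₂ * + toℕ j
    ; x₂ = s tᵢ + A₁ * + toℕ (opposite j)
    ; x₃ = x₀ + d * + toℕ i
    ; 0≤x₁ = ℤ.+-mono-≤ (0≤floor-rem (tᵢ * I₁) A₂ 0<A₂) (pos*nonNeg 0<A₂ (+≤+ z≤n))
    ; 0≤x₂ = ℤ.+-mono-≤ (0≤floor-rem (tᵢ * I₂) A₁ 0<A₁) (pos*nonNeg 0<A₁ (+≤+ z≤n))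
    ; 0≤x₃ = ℤ.+-mono-≤ (0≤floor-rem (m′ * I₃) d 0<d) (pos*nonNeg 0<d (+≤+ z≤n))
    -- The equation `A₁ x + A₂ y = M - A₃ i` is multiplied by `d d₀`; the remaining equalities
    -- restore `a₁`, `a₂`, `a₃` and `m`.
    ; sum = linear (r tᵢ + A₂ * + toℕ j) a₁≡
        (linear (s tᵢ + A₁ * + toℕ (opposite j)) a₂≡
        (linear (x₀ + d * + toℕ i) a₃≡
        (linear (- 1ℤ) m≡ (linear (- d₀) m′≡
        (linear (d * d₀) (represents tᵢ (+ toℕ j) (+ toℕ (opposite j)) total)
          (identity A₁ A₂ A₃ d d₀ a₁ a₂ a₃ m m′ M
            (r tᵢ + A₂ * + toℕ j) (s tᵢ + A₁ * + toℕ (opposite j)) x₀ (+ toℕ i)))))))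
    }
    where
    tᵢ = t (toℕ i)
    total : 1ℤ + (+ toℕ j + + toℕ (opposite j)) ≡ q tᵢ
    total = trans (cong +_ (toℕ+opposite j)) (+N≡q (toℕ<n i))
    identity : ∀ A₁ A₂ A₃ d d₀ a₁ a₂ a₃ m m′ M x y x₀ e → x * a₁ + y * a₂ + (x₀ + d * e) * a₃ ≡
      m + x * (a₁ - A₁ * d * d₀) + y * (a₂ - A₂ * d * d₀) + (x₀ + d * e) * (a₃ - A₃ * d₀)
        + (- 1ℤ) * (m - m′ * d₀) + (- d₀) * (m′ - (M * d + A₃ * x₀))
        + d * d₀ * (A₁ * x + A₂ * y - (M - A₃ * e))
    identity = solve-∀

  -- `x₃` recovers `i` since `d > 0`, and then `x₁` recovers `j` since `A₂ > 0`. The offset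
  -- `r (t i)` depends on `i`, so it is first rewritten along `i≡i′`.
  solution-injective : ∀ {p p′} → solution p ≡ solution p′ → p ≡ p′
  solution-injective {i , j} {i′ , j′} eq = Fin-pair-≡ N i≡i′
    (+-*-injective {r (t (toℕ i))} {A₂} 0<A₂ (trans (cong Solution.x₁ eq)
      (cong (λ z → r (t (toℕ z)) + A₂ * + toℕ j′) (sym i≡i′))))
    where
    i≡i′ : i ≡ i′
    i≡i′ = toℕ-injective (+-*-injective {x₀} {d} 0<d (cong Solution.x₃ eq))

  solution-surjective : ∀ x → ∃[ p ] solution p ≡ x
  solution-surjective record
    { x₁ = x₁ ; x₂ = x₂ ; x₃ = x₃ ; 0≤x₁ = 0≤x₁ ; 0≤x₂ = 0≤x₂ ; 0≤x₃ = 0≤x₃ ; sum = total } =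
    let
      -- The quotient of `x₃ - x₀` by `d`: modulo `d` the equation reads `A₃ x₃ ≡ m′`, and
      -- multiplying by `I₃` with `A₃ I₃ + d v₃ = 1` gives this explicit value.
      e  = x₃ * v₃ - (x₁ * A₁ + x₂ * A₂) * I₃ + floor ((m′ * I₃) /ℚ d)
      sum′ : m′ ≡ x₁ * (A₁ * d) + x₂ * (A₂ * d) + x₃ * A₃
      sum′ = ℤ.*-cancelʳ-≡ _ _ d₀ {{>-nonZero 0<d₀}}
        (linear (- 1ℤ) m≡ (linear (- 1ℤ) total (linear x₁ a₁≡ (linear x₂ a₂≡ (linear x₃ a₃≡
          (identity₁ A₁ A₂ A₃ d d₀ a₁ a₂ a₃ m m′ x₁ x₂ x₃))))))
      x₃≡ : x₃ ≡ x₀ + d * e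
      x₃≡ = linear (- x₃) inverse₃ (linear (- I₃) sum′
        (identity₂ A₁ A₂ A₃ I₃ v₃ d m′ x₁ x₂ x₃ (floor ((m′ * I₃) /ℚ d))))
      +e : + ∣ e ∣ ≡ e
      +e = ℤ.0≤i⇒+∣i∣≡i (quotient-nonNeg 0<d 0≤x₃ (floor-rem<d (m′ * I₃) d 0<d) x₃≡)
      rest : A₁ * x₁ + A₂ * x₂ ≡ t ∣ e ∣
      rest = trans (ℤ.*-cancelʳ-≡ _ _ d {{>-nonZero 0<d}}
        (linear (- 1ℤ) sum′ (linear 1ℤ m′≡ (linear (- A₃) x₃≡
          (identity₃ A₁ A₂ A₃ d m′ M x₁ x₂ x₃ x₀ e)))))
        (cong (λ z → M - A₃ * z) (sym +e))
      -- `M - A₃ e` equals `A₁ x₁ + A₂ x₂`, which is nonnegative.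
      i<k : ∣ e ∣ ℕ.< k
      i<k = below⁻¹ (ℤ.0≤i-j⇒j≤i (subst (0ℤ ≤_) rest
        (ℤ.+-mono-≤ (pos*nonNeg 0<A₁ 0≤x₁) (pos*nonNeg 0<A₂ 0≤x₂))))
      i  = fromℕ< i<k
      i≡ = toℕ-fromℕ< i<k
      j , l , x₁≡ , x₂≡ , j+l = represented 0≤x₁ 0≤x₂ (trans rest (cong t (sym i≡)))
      jᵢ , j≡ , l≡ = split-Fin j l (cong ∣_∣ j+l)
    in (i , jᵢ) , solution-≡
      (trans (cong (λ z → r (t (toℕ i)) + A₂ * + z) j≡) (sym x₁≡))
      (trans (cong (λ z → s (t (toℕ i)) + A₁ * + z) l≡) (sym x₂≡))
      (trans (cong (λ z → x₀ + d * z) (trans (cong +_ i≡) +e)) (sym x₃≡))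
    where
    identity₁ : ∀ A₁ A₂ A₃ d d₀ a₁ a₂ a₃ m m′ x₁ x₂ x₃ →
      m′ * d₀ ≡ (x₁ * (A₁ * d) + x₂ * (A₂ * d) + x₃ * A₃) * d₀
        + (- 1ℤ) * (m - m′ * d₀) + (- 1ℤ) * (x₁ * a₁ + x₂ * a₂ + x₃ * a₃ - m)
        + x₁ * (a₁ - A₁ * d * d₀) + x₂ * (a₂ - A₂ * d * d₀) + x₃ * (a₃ - A₃ * d₀)
    identity₁ = solve-∀
    identity₂ : ∀ A₁ A₂ A₃ I v d m′ x₁ x₂ x₃ f →
      x₃ ≡ (m′ * I - f * d) + d * (x₃ * v - (x₁ * A₁ + x₂ * A₂) * I + f)
        + (- x₃) * (A₃ * I + d * v - 1ℤ) + (- I) * (m′ - (x₁ * (A₁ * d) + x₂ * (A₂ * d) + x₃ * A₃))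
    identity₂ = solve-∀
    identity₃ : ∀ A₁ A₂ A₃ d m′ M x₁ x₂ x₃ x₀ e →
      (A₁ * x₁ + A₂ * x₂) * d ≡ (M - A₃ * e) * d
        + (- 1ℤ) * (m′ - (x₁ * (A₁ * d) + x₂ * (A₂ * d) + x₃ * A₃))
        + 1ℤ * (m′ - (M * d + A₃ * x₀)) + (- A₃) * (x₃ - (x₀ + d * e))
    identity₃ = solve-∀

  count : p[ a₁ , a₂ , a₃ ]⟨ m ⟩≔ sum (applyUpTo N k)
  count = ⤖⇒↔ (mk⤖ (solution-injective , λ x →
    let p , eq = solution-surjective x in p , λ { refl → eq })) ↔-∘ Fin-sum N k

-- Eventual signs of quasi-polynomials.

always : ∀ {P : ℕ → Set} → (∀ n → P n) → Eventually P
always p = 0 , λ n _ → p n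

infixl 4 _⊛_
_⊛_ : ∀ {P Q : ℕ → Set} → Eventually (λ n → P n → Q n) → Eventually P → Eventually Q
(N , f) ⊛ (N′ , p) = N ℕ.⊔ N′ , λ n N≤n →
  f n (ℕ.≤-trans (ℕ.m≤m⊔n N N′) N≤n) (p n (ℕ.≤-trans (ℕ.m≤n⊔m N N′) N≤n))

eval-zero : ∀ p → IsZero p → ∀ x → eval p x ≡ 0ℤ
eval-zero []      _ _ = refl
eval-zero (c ∷ p) z x = trans (cong₂ (λ c v → c + x * v) (z 0) (eval-zero p (z ∘ suc) x))
  (trans (ℤ.+-identityˡ (x * 0ℤ)) (ℤ.*-zeroʳ x))

0≤i+∣i∣ : ∀ i → 0ℤ ≤ i + + ∣ i ∣
0≤i+∣i∣ (+ n)    = +≤+ z≤n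
0≤i+∣i∣ -[1+ n ] = ℤ.≤-reflexive (sym (ℤ.n⊖n≡0 (suc n)))

-- Induction along Horner's scheme. Once the tail has a positive integer value, that value is at
-- least 1, so `m > |c|` outweighs the constant term.
eval-positive : ∀ p → HasPositiveLeadingCoeff p → Eventually (λ m → 0ℤ < eval p (+ m))
eval-positive []      (_ , +<+ () , _)
eval-positive (c ∷ p) (zero , 0<c , zeros) = 0 , λ m _ →
  subst (0ℤ <_) (sym (trans (cong (λ v → c + + m * v) (eval-zero p (λ k → zeros (suc k) (s≤s z≤n)) (+ m)))
    (trans (cong (λ v → c + v) (ℤ.*-zeroʳ (+ m))) (ℤ.+-identityʳ c)))) 0<c
eval-positive (c ∷ p) (suc k , 0<lead , zeros)
  with eval-positive p (k , 0<lead , λ j k<j → zeros (suc j) (s≤s k<j))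
... | N , 0<eval = N ℕ.⊔ suc ∣ c ∣ , λ m N≤m → positive-at m
    (0<eval m (ℕ.≤-trans (ℕ.m≤m⊔n N _) N≤m)) (ℕ.≤-trans (ℕ.m≤n⊔m N _) N≤m)
  where
  -- c + m e = (c + |c|) + (m − |c|) + m (e − 1)
  positive-at : ∀ m → 0ℤ < eval p (+ m) → ∣ c ∣ ℕ.< m → 0ℤ < c + + m * eval p (+ m)
  positive-at m 0<e c<m = subst (0ℤ <_) (identity c (+ ∣ c ∣) (+ m) (eval p (+ m)))
    (ℤ.+-mono-<-≤ (ℤ.+-mono-≤-< (0≤i+∣i∣ c) (i<j⇒0<j-i (+<+ c<m)))
      (pos*nonNeg {+ m} (+<+ (ℕ.≤-trans (s≤s z≤n) c<m)) (ℤ.i≤j⇒0≤j-i (ℤ.i<j⇒suc[i]≤j 0<e))))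
    where
    identity : ∀ c a m e → (c + a) + (m - a) + m * (e - 1ℤ) ≡ c + m * e
    identity = solve-∀

Fin-bound : ∀ {n} (N : Fin n → ℕ) → ∃[ B ] (∀ i → N i ℕ.≤ B)
Fin-bound {zero}  N = 0 , λ ()
Fin-bound {suc n} N with Fin-bound (N ∘ suc)
... | B , N≤B = N zero ℕ.⊔ B , λ
  { zero    → ℕ.m≤m⊔n (N zero) B
  ; (suc i) → ℕ.≤-trans (N≤B i) (ℕ.m≤n⊔m (N zero) B) }

-- There are finitely many residue classes mod `T`, so their thresholds have a common bound `B`.
constituentwise : ∀ {f} (P : ℤ → Set) (q : IsQuasiPolynomial f) →
  (∀ i → Eventually (λ m → P (eval (constituent q i) (+ m)))) → Eventually (P ∘ f)
constituentwise {f} P q ev with Fin-bound (proj₁ ∘ ev)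
-- `suc C` puts `n` in the range of `agrees`, and `B * T` forces `n / T ≥ B`.
... | B , N≤B = suc C ℕ.+ B ℕ.* T , λ n bound≤n →
  let
    i = fromℕ< (ℕ.m%n<n n T)
    n≡ : T ℕ.* (n ℕ./ T) ℕ.+ toℕ i ≡ n
    n≡ = trans (cong₂ ℕ._+_ (ℕ.*-comm T (n ℕ./ T)) (toℕ-fromℕ< (ℕ.m%n<n n T)))
           (trans (ℕ.+-comm _ (n ℕ.% T)) (sym (ℕ.m≡m%n+[m/n]*n n T)))
    B≤n/T : B ℕ.≤ n ℕ./ T
    B≤n/T = subst (ℕ._≤ n ℕ./ T) (ℕ.m*n/n≡m B T)
              (ℕ./-monoˡ-≤ T (ℕ.≤-trans (ℕ.m≤n+m (B ℕ.* T) (suc C)) bound≤n))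
  in subst (P ∘ f) n≡ (subst P
       (sym (agrees i (n ℕ./ T) (subst (C ℕ.<_) (sym n≡) (ℕ.≤-trans (ℕ.m≤m+n (suc C) _) bound≤n))))
       (proj₂ (ev i) (n ℕ./ T) (ℕ.≤-trans (N≤B i) B≤n/T)))
  where
  open IsQuasiPolynomial q using (T; C; 0<T; agrees)
  instance _ = ℕ.>-nonZero 0<T

eventually-positive : ∀ {f} → HasPositiveLeadingCoeffs f → Eventually (λ n → 0ℤ < f n)
eventually-positive (q , lead) = constituentwise (0ℤ <_) q (λ i → eval-positive (constituent q i) (lead i))

eventually-nonNeg : ∀ {f} → f ≽0 → Eventually (λ n → 0ℤ ≤ f n)
eventually-nonNeg (q , sign) = constituentwise (0ℤ ≤_) q λ i → nonNeg (constituent q i) (sign i)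
  where
  nonNeg : ∀ p → IsZero p ⊎ HasPositiveLeadingCoeff p → Eventually (λ m → 0ℤ ≤ eval p (+ m))
  nonNeg p (inj₁ z)    = always λ m → ℤ.≤-reflexive (sym (eval-zero p z (+ m)))
  nonNeg p (inj₂ lead) = always (λ _ → ℤ.<⇒≤) ⊛ eval-positive p lead

-- Rational sums and their integer terms.

frac-*ι : ∀ a d → d ≢ 0ℤ → frac (a /ℚ d) ℚ.* ι d ≡ ι (floor-rem a d)
frac-*ι a d d≢0 = begin
  (y ℚ.- ι (floor y)) ℚ.* ι d             ≡⟨ ℚ.*-distribʳ-+ (ι d) y (ℚ.- ι (floor y)) ⟩
  y ℚ.* ι d ℚ.+ ℚ.- ι (floor y) ℚ.* ι d   ≡⟨ cong₂ ℚ._+_ (/ℚ-* a d d≢0) (sym (ℚ.neg-distribˡ-* (ι (floor y)) (ι d))) ⟩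
  ι a ℚ.- ι (floor y) ℚ.* ι d             ≡⟨ cong (λ z → ι a ℚ.- z) (ι-* (floor y) d) ⟩
  ι a ℚ.- ι (floor y * d)                 ≡⟨ cong (ι a ℚ.+_) (neg-ι (floor y * d)) ⟩
  ι a ℚ.+ ι (- (floor y * d))             ≡⟨ ι-+ a (- (floor y * d)) ⟩
  ι (floor-rem a d)                       ∎
  where
  open ≡-Reasoning
  y = a /ℚ d

residue≡floor-rem : ∀ a d → d ≢ 0ℤ → residue a d ≡ floor-rem a d
residue≡floor-rem a d d≢0 = trans (cong floor (frac-*ι a d d≢0)) (floor-ι (floor-rem a d))

Σ< : ℕ → (ℕ → ℚ) → ℚ
Σ< k f = foldr ℚ._+_ 0ℚ (applyUpTo f k)

-- Splitting on `K` lets the number of terms compute: `K + 1` for `K ≥ -1`, and 0 below. The case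
-- `-1` is separate because its successor is already nonnegative; `n + 0` comes from subtracting the
-- lower limit 0.
∑-range : ∀ K → ∃[ k ] ((∀ f → ∑ 0ℤ K f ≡ Σ< k (f ∘ +_)) ×
  (∀ {i} → i ℕ.< k → + i ≤ K) × (∀ {i} → + i ≤ K → i ℕ.< k))
∑-range (+ n) = suc (n ℕ.+ 0) , (λ f → refl) ,
  (λ { (s≤s i≤n) → +≤+ (subst (_ ℕ.≤_) (ℕ.+-identityʳ n) i≤n) }) ,
  (λ { (+≤+ i≤n) → s≤s (subst (_ ℕ.≤_) (sym (ℕ.+-identityʳ n)) i≤n) })
∑-range -[1+ zero ]  = 0 , (λ f → refl) , (λ ()) , λ ()
∑-range -[1+ suc n ] = 0 , (λ f → refl) , (λ ()) , λ ()

module _ where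
  open ℚ.+-*-Solver

  linearℚ : ∀ {x y l r} c → l ≡ r → x ≡ y ℚ.+ c ℚ.* (l ℚ.- r) → x ≡ y
  linearℚ {y = y} {r = r} c refl x≡ = trans x≡
    (solve 3 (λ y c r → y :+ c :* (r :- r) := y) refl y c r)

  -- The termwise identity is asked for only at `i < k`, where `N i` is known to equal `q (t i)`.
  Σ<-combine : ∀ (N : ℕ → ℕ) (f g h : ℕ → ℚ) u v k →
    (∀ {i} → i ℕ.< k → ι (+ N i) ≡ f i ℚ.- u ℚ.* g i ℚ.- v ℚ.* h i) →
    ι (+ sum (applyUpTo N k)) ≡ Σ< k f ℚ.- u ℚ.* Σ< k g ℚ.- v ℚ.* Σ< k h
  Σ<-combine N f g h u v zero    eq =
    solve 2 (λ u v → con 0ℚ := con 0ℚ :- u :* con 0ℚ :- v :* con 0ℚ) refl u v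
  Σ<-combine N f g h u v (suc k) eq = trans (sym (ι-+ (+ N 0) (+ sum (applyUpTo (N ∘ suc) k))))
    (trans (cong₂ ℚ._+_ (eq (s≤s z≤n))
        (Σ<-combine (N ∘ suc) (f ∘ suc) (g ∘ suc) (h ∘ suc) u v k (eq ∘ s≤s)))
      (solve 8 (λ u v f g h F G H → (f :- u :* g :- v :* h) :+ (F :- u :* G :- v :* H)
        := (f :+ F) :- u :* (g :+ G) :- v :* (h :+ H)) refl
        u v (f 0) (g 0) (h 0) (Σ< k (f ∘ suc)) (Σ< k (g ∘ suc)) (Σ< k (h ∘ suc))))

  -- Multiplying the last equation by `uv = 1/(ab)` solves it for `q`. The reciprocals enter as
  -- variables with their defining equations, which keeps the identity polynomial.
  divide-out : ∀ a b r s t q X u v → X ℚ.* (a ℚ.* b) ≡ t → u ℚ.* a ≡ 1ℚ → v ℚ.* b ≡ 1ℚ →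
    t ℚ.+ a ℚ.* b ≡ a ℚ.* r ℚ.+ b ℚ.* s ℚ.+ a ℚ.* b ℚ.* q →
    q ≡ X ℚ.+ 1ℚ ℚ.- v ℚ.* r ℚ.- u ℚ.* s
  divide-out a b r s t q X u v Xab≡t ua≡1 vb≡1 eq =
    linearℚ (ℚ.- (u ℚ.* v)) Xab≡t (linearℚ (ℚ.- (u ℚ.* v)) eq
    (linearℚ (v ℚ.* b ℚ.* (X ℚ.+ 1ℚ ℚ.- q) ℚ.- v ℚ.* r) ua≡1
    (linearℚ (X ℚ.+ 1ℚ ℚ.- q ℚ.- u ℚ.* s) vb≡1
    (solve 9 (λ a b r s t q X u v → q := X :+ con 1ℚ :- v :* r :- u :* s
      :+ (:- (u :* v)) :* (X :* (a :* b) :- t)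
      :+ (:- (u :* v)) :* (t :+ a :* b :- (a :* r :+ b :* s :+ a :* b :* q))
      :+ (v :* b :* (X :+ con 1ℚ :- q) :- v :* r) :* (u :* a :- con 1ℚ)
      :+ (X :+ con 1ℚ :- q :- u :* s) :* (v :* b :- con 1ℚ)) refl a b r s t q X u v))))

pos⇒≢0 : ∀ {i} → 0ℤ < i → i ≢ 0ℤ
pos⇒≢0 0<i i≡0 = ℤ.<⇒≢ 0<i (sym i≡0)

nonNeg∧≢0⇒pos : ∀ {i} → 0ℤ ≤ i → i ≢ 0ℤ → 0ℤ < i
nonNeg∧≢0⇒pos 0≤i i≢0 = ℤ.≤∧≢⇒< 0≤i (i≢0 ∘ sym)

÷-positive : ∀ {a b} → 0ℤ < a → 0ℤ < b → b ∣ a → 0ℤ < a ÷ b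
÷-positive {a} {b} 0<a 0<b b∣a = pos*-cancel 0<b
  (subst (0ℤ <_) (trans (sym (÷-exact a b (pos⇒≢0 0<b) b∣a)) (ℤ.*-comm (a ÷ b) b)) 0<a)

χ-∣ : ∀ {m d₀} → d₀ ∣ m → χ m d₀ ≡ 1ℚ
χ-∣ {m} {d₀} d₀∣m = cong (if_then 1ℚ else 0ℚ) (dec-true (d₀ ∣? m) d₀∣m)

χ-∤ : ∀ {m d₀} → ¬ d₀ ∣ m → χ m d₀ ≡ 0ℚ
χ-∤ {m} {d₀} d₀∤m = cong (if_then 1ℚ else 0ℚ) (dec-false (d₀ ∣? m) d₀∤m)

-- The formula at a single value of n.

module _ (a₁ a₂ a₃ m d₀ d I₃ v₃ I₁ v₁ I₂ v₂ : ℤ)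
  (0<a₁ : 0ℤ < a₁) (0<a₂ : 0ℤ < a₂) (0<a₃ : 0ℤ < a₃) (0<d₀ : 0ℤ < d₀) (0<d : 0ℤ < d)
  (d₀∣a₁ : d₀ ∣ a₁) (d₀∣a₂ : d₀ ∣ a₂) (d₀∣a₃ : d₀ ∣ a₃)
  (d∣a₁′ : d ∣ a₁ ÷ d₀) (d∣a₂′ : d ∣ a₂ ÷ d₀)
  (inverse₃ : a₃ ÷ d₀ * I₃ + d * v₃ ≡ 1ℤ)
  (inverse₁ : a₁ ÷ d₀ ÷ d * I₁ + a₂ ÷ d₀ ÷ d * v₁ ≡ 1ℤ)
  (inverse₂ : a₂ ÷ d₀ ÷ d * I₂ + a₁ ÷ d₀ ÷ d * v₂ ≡ 1ℤ) where

  private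
    A₁ = a₁ ÷ d₀ ÷ d
    A₂ = a₂ ÷ d₀ ÷ d
    A₃ = a₃ ÷ d₀
    m′ = m ÷ d₀
    x₀ = residue (m′ * I₃) d
    M  = (m′ - A₃ * x₀) ÷ d
    K  = floor (M /ℚ A₃)
    value : ℚ
    value = ∑ 0ℤ K (λ x → (M - A₃ * x) /ℚ (A₁ * A₂) ℚ.+ 1ℚ)
      ℚ.- (+ 1) /ℚ A₂ ℚ.* S 0ℤ K (M * I₁) (- (A₃ * I₁)) A₂
      ℚ.- (+ 1) /ℚ A₁ ℚ.* S 0ℤ K (M * I₂) (- (A₃ * I₂)) A₁

  Solution⇒∣ : Solution a₁ a₂ a₃ m → d₀ ∣ m
  Solution⇒∣ record { x₁ = x₁ ; x₂ = x₂ ; x₃ = x₃ ; sum = total } = subst (d₀ ∣_) total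
    (∣m∣n⇒∣m+n (∣m∣n⇒∣m+n (∣n⇒∣m*n x₁ d₀∣a₁) (∣n⇒∣m*n x₂ d₀∣a₂)) (∣n⇒∣m*n x₃ d₀∣a₃))

  count-divisible : d₀ ∣ m → ∃[ k ] (p[ a₁ , a₂ , a₃ ]⟨ m ⟩≔ k × ι (+ k) ≡ value)
  count-divisible d₀∣m = sum (applyUpTo N k) , count , trans
    (Σ<-combine N (c ∘ +_) (s₁ ∘ +_) (s₂ ∘ +_) ((+ 1) /ℚ A₂) ((+ 1) /ℚ A₁) k term)
    (sym (cong₂ ℚ._-_ (cong₂ ℚ._-_ (∑≡Σ< c) (cong ((+ 1) /ℚ A₂ ℚ.*_) (∑≡Σ< s₁)))
                      (cong ((+ 1) /ℚ A₁ ℚ.*_) (∑≡Σ< s₂))))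
    where
    d₀≢0 = pos⇒≢0 0<d₀
    d≢0  = pos⇒≢0 0<d
    0<A₁ = ÷-positive (÷-positive 0<a₁ 0<d₀ d₀∣a₁) 0<d d∣a₁′
    0<A₂ = ÷-positive (÷-positive 0<a₂ 0<d₀ d₀∣a₂) 0<d d∣a₂′
    0<A₃ = ÷-positive 0<a₃ 0<d₀ d₀∣a₃

    x₀≡ : x₀ ≡ floor-rem (m′ * I₃) d
    x₀≡ = residue≡floor-rem (m′ * I₃) d d≢0

    -- With `x₀ = m′ I₃ - f d`, the difference is `m′(1 - A₃ I₃) + A₃ f d`, and `1 - A₃ I₃ = d v₃`.
    d∣m′-A₃x₀ : d ∣ m′ - A₃ * x₀
    d∣m′-A₃x₀ = divides (m′ * v₃ + A₃ * f) (linear (- A₃) x₀≡ (linear (- m′) inverse₃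
      (identity m′ A₃ x₀ d v₃ I₃ f)))
      where
      f = floor ((m′ * I₃) /ℚ d)
      identity : ∀ m A x d v I f → m - A * x ≡ (m * v + A * f) * d
        + (- A) * (x - (m * I - f * d)) + (- m) * (A * I + d * v - 1ℤ)
      identity = solve-∀

    m′≡ : m′ ≡ M * d + A₃ * floor-rem (m′ * I₃) d
    m′≡ = trans (identity m′ (A₃ * x₀))
      (cong₂ (λ y x → y + A₃ * x) (sym (÷-exact (m′ - A₃ * x₀) d d≢0 d∣m′-A₃x₀)) x₀≡)
      where
      identity : ∀ x y → x ≡ x - y + y
      identity = solve-∀

    ÷÷-exact : ∀ {a} → d₀ ∣ a → d ∣ a ÷ d₀ → a ≡ a ÷ d₀ ÷ d * d * d₀
    ÷÷-exact {a} d₀∣a d∣a′ = sym (trans (cong (_* d₀) (÷-exact (a ÷ d₀) d d≢0 d∣a′)) (÷-exact a d₀ d₀≢0 d₀∣a))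

    k    = proj₁ (∑-range K)
    ∑≡Σ< = proj₁ (proj₂ (∑-range K))

    below : ∀ {i} → i ℕ.< k → A₃ * + i ≤ M
    below i<k = floor-adjoint M A₃ 0<A₃ _ (proj₁ (proj₂ (proj₂ (∑-range K))) i<k)

    below⁻¹ : ∀ {i} → A₃ * + i ≤ M → i ℕ.< k
    below⁻¹ A₃i≤M = proj₂ (proj₂ (proj₂ (∑-range K))) (floor-adjoint⁻¹ M A₃ 0<A₃ _ A₃i≤M)

    open Reduction M I₁ v₁ I₂ v₂ m′ I₃ v₃ 0<A₁ 0<A₂ 0<A₃ 0<d 0<d₀ inverse₁ inverse₂ inverse₃
      (÷÷-exact d₀∣a₁ d∣a₁′) (÷÷-exact d₀∣a₂ d∣a₂′) (sym (÷-exact a₃ d₀ d₀≢0 d₀∣a₃))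
      (sym (÷-exact m d₀ d₀≢0 d₀∣m)) m′≡ k below below⁻¹
      hiding (x₀)

    c s₁ s₂ : ℤ → ℚ
    c  x = (M - A₃ * x) /ℚ (A₁ * A₂) ℚ.+ 1ℚ
    s₁ x = frac ((M * I₁ + - (A₃ * I₁) * x) /ℚ A₂) ℚ.* ι A₂
    s₂ x = frac ((M * I₂ + - (A₃ * I₂) * x) /ℚ A₁) ℚ.* ι A₁

    -- Factoring out the inverse identifies the summands of the two sums `S` with the residues
    -- `r (t i)` and `s (t i)`.
    numerator : ∀ M A I x → M * I + - (A * I) * x ≡ (M - A * x) * I
    numerator = solve-∀

    s₁≡ : ∀ i → s₁ (+ i) ≡ ι (r (t i))
    s₁≡ i = trans (cong (λ z → frac (z /ℚ A₂) ℚ.* ι A₂) (numerator M A₃ I₁ (+ i)))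
                  (frac-*ι (t i * I₁) A₂ (pos⇒≢0 0<A₂))

    s₂≡ : ∀ i → s₂ (+ i) ≡ ι (s (t i))
    s₂≡ i = trans (cong (λ z → frac (z /ℚ A₁) ℚ.* ι A₁) (numerator M A₃ I₂ (+ i)))
                  (frac-*ι (t i * I₂) A₁ (pos⇒≢0 0<A₁))

    decomposeℚ : ∀ i → ι (t i) ℚ.+ ι A₁ ℚ.* ι A₂ ≡
      ι A₁ ℚ.* ι (r (t i)) ℚ.+ ι A₂ ℚ.* ι (s (t i)) ℚ.+ ι A₁ ℚ.* ι A₂ ℚ.* ι (q (t i))
    decomposeℚ i = begin
      ι (t i) ℚ.+ ι A₁ ℚ.* ι A₂ ≡⟨ cong (ι (t i) ℚ.+_) (ι-* A₁ A₂) ⟩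
      ι (t i) ℚ.+ ι (A₁ * A₂)   ≡⟨ ι-+ (t i) (A₁ * A₂) ⟩
      ι (t i + A₁ * A₂)         ≡⟨ cong ι (decompose (t i)) ⟩
      ι (A₁ * R + A₂ * S′ + A₁ * A₂ * Q)              ≡⟨ ι-+ (A₁ * R + A₂ * S′) (A₁ * A₂ * Q) ⟨
      ι (A₁ * R + A₂ * S′) ℚ.+ ι (A₁ * A₂ * Q)        ≡⟨ cong₂ ℚ._+_ (ι-+ (A₁ * R) (A₂ * S′)) (ι-* (A₁ * A₂) Q) ⟨
      ι (A₁ * R) ℚ.+ ι (A₂ * S′) ℚ.+ ι (A₁ * A₂) ℚ.* ι Q
        ≡⟨ cong₂ ℚ._+_ (cong₂ ℚ._+_ (ι-* A₁ R) (ι-* A₂ S′)) (cong (ℚ._* ι Q) (ι-* A₁ A₂)) ⟨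
      ι A₁ ℚ.* ι R ℚ.+ ι A₂ ℚ.* ι S′ ℚ.+ ι A₁ ℚ.* ι A₂ ℚ.* ι Q ∎
      where
      open ≡-Reasoning
      R = r (t i)
      S′ = s (t i)
      Q = q (t i)

    term : ∀ {i} → i ℕ.< k → ι (+ N i) ≡
      c (+ i) ℚ.- (+ 1) /ℚ A₂ ℚ.* s₁ (+ i) ℚ.- (+ 1) /ℚ A₁ ℚ.* s₂ (+ i)
    term {i} i<k = trans (cong ι (+N≡q i<k)) (trans
      -- `r` is the residue mod `A₂` and is weighted by `1/A₂`; `s` is the residue mod `A₁` and is
      -- weighted by `1/A₁`.
      (divide-out (ι A₁) (ι A₂) (ι (r (t i))) (ι (s (t i))) (ι (t i)) (ι (q (t i)))
        (t i /ℚ (A₁ * A₂)) ((+ 1) /ℚ A₁) ((+ 1) /ℚ A₂)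
        (trans (cong (t i /ℚ (A₁ * A₂) ℚ.*_) (ι-* A₁ A₂))
               (/ℚ-* (t i) (A₁ * A₂) (pos⇒≢0 (pos*pos 0<A₁ 0<A₂))))
        (/ℚ-* (+ 1) A₁ (pos⇒≢0 0<A₁)) (/ℚ-* (+ 1) A₂ (pos⇒≢0 0<A₂)) (decomposeℚ i))
      (sym (cong₂ (λ x y → c (+ i) ℚ.- (+ 1) /ℚ A₂ ℚ.* x ℚ.- (+ 1) /ℚ A₁ ℚ.* y) (s₁≡ i) (s₂≡ i))))

  count-pointwise : ∃[ k ] (p[ a₁ , a₂ , a₃ ]⟨ m ⟩≔ k × ι (+ k) ≡ χ m d₀ ℚ.* value)
  count-pointwise = by-cases (d₀ ∣? m)
    where
    by-cases : Dec (d₀ ∣ m) → ∃[ k ] (p[ a₁ , a₂ , a₃ ]⟨ m ⟩≔ k × ι (+ k) ≡ χ m d₀ ℚ.* value)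
    by-cases (yes d₀∣m) = let k , counts , eq = count-divisible d₀∣m in
      k , counts , trans eq (sym (trans (cong (ℚ._* value) (χ-∣ d₀∣m)) (ℚ.*-identityˡ value)))
    -- A solution would write `m` as a combination of multiples of `d₀`, so there is none, and `χ`
    -- makes the right side 0.
    by-cases (no d₀∤m) = 0 ,
      mk↔ₛ′ (λ ()) (λ x → contradiction (Solution⇒∣ x) d₀∤m)
            (λ x → contradiction (Solution⇒∣ x) d₀∤m) (λ ()) ,
      sym (trans (cong (ℚ._* value) (χ-∤ d₀∤m)) (ℚ.*-zeroˡ value))

-- The formula for all large n.

theorem4p3 :
  ∀ (a₁ a₂ a₃ m : ℕ → ℤ) →
  HasPositiveLeadingCoeffs a₁ → HasPositiveLeadingCoeffs a₂ →
  HasPositiveLeadingCoeffs a₃ → HasPositiveLeadingCoeffs m →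
  ∀ (d₀ : ℕ → ℤ) → IsGGCD d₀ (a₁ ∷ a₂ ∷ a₃ ∷ []) →
  let m′  = λ n → m n ÷ d₀ n
      a₁′ = λ n → a₁ n ÷ d₀ n
      a₂′ = λ n → a₂ n ÷ d₀ n
      a₃′ = λ n → a₃ n ÷ d₀ n
  in
  ∀ (d : ℕ → ℤ) → IsGGCD d (a₁′ ∷ a₂′ ∷ []) →
  ∀ (a₃′⁻¹ : ℕ → ℤ) → IsInverse a₃′⁻¹ a₃′ d →
  let x₀ = λ n → residue (m′ n * a₃′⁻¹ n) (d n)
      m̃  = λ n → (m′ n - a₃′ n * x₀ n) ÷ d n
      ã₁ = λ n → a₁′ n ÷ d n
      ã₂ = λ n → a₂′ n ÷ d n
  in
  ∀ (ã₁⁻¹ : ℕ → ℤ) → IsInverse ã₁⁻¹ ã₁ ã₂ →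
  ∀ (ã₂⁻¹ : ℕ → ℤ) → IsInverse ã₂⁻¹ ã₂ ã₁ →
  Eventually λ n →
    let M   = m̃ n
        A₁  = ã₁ n
        A₂  = ã₂ n
        A₃  = a₃′ n
        I₁  = ã₁⁻¹ n
        I₂  = ã₂⁻¹ n
        K   = floor (M /ℚ A₃)
        C   = ∑ 0ℤ K (λ x → (M - A₃ * x) /ℚ (A₁ * A₂) ℚ.+ 1ℚ)
    in
    ∃[ k ] (p[ a₁ n , a₂ n , a₃ n ]⟨ m n ⟩≔ k ×
            ι (+ k) ≡
              χ (m n) (d₀ n) ℚ.*
              (C ℚ.- (+ 1) /ℚ A₂ ℚ.* S 0ℤ K (M * I₁) (- (A₃ * I₁)) A₂
                 ℚ.- (+ 1) /ℚ A₁ ℚ.* S 0ℤ K (M * I₂) (- (A₃ * I₂)) A₁))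
theorem4p3 a₁ a₂ a₃ m pos₁ pos₂ pos₃ _ d₀ ggcd₀ d ggcd _ (_ , _ , _ , inverse₃)
    _ (_ , _ , _ , inverse₁) _ (_ , _ , _ , inverse₂)
  with IsGGCD.common ggcd₀ | IsGGCD.common ggcd
... | d₀∣a₁ ∷ d₀∣a₂ ∷ d₀∣a₃ ∷ _ | d∣a₁′ ∷ d∣a₂′ ∷ _ =
  -- Each ggcd is eventually nonnegative by `≽0` and nonzero by `_∣ᴿ_`, hence positive; `_⊛_` takes
  -- the maximum of all the thresholds.
  always (λ n 0<a₁ 0<a₂ 0<a₃ 0≤d₀ (d₀≢0 , d₀∣a₁) (_ , d₀∣a₂) (_ , d₀∣a₃) 0≤d (d≢0 , d∣a₁′) (_ , d∣a₂′) →
    count-pointwise (a₁ n) (a₂ n) (a₃ n) (m n) (d₀ n) (d n) _ _ _ _ _ _ 0<a₁ 0<a₂ 0<a₃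
      (nonNeg∧≢0⇒pos 0≤d₀ d₀≢0) (nonNeg∧≢0⇒pos 0≤d d≢0) d₀∣a₁ d₀∣a₂ d₀∣a₃ d∣a₁′ d∣a₂′)
  ⊛ eventually-positive pos₁ ⊛ eventually-positive pos₂ ⊛ eventually-positive pos₃
  ⊛ eventually-nonNeg (IsGGCD.nonNegative ggcd₀) ⊛ d₀∣a₁ ⊛ d₀∣a₂ ⊛ d₀∣a₃
  ⊛ eventually-nonNeg (IsGGCD.nonNegative ggcd) ⊛ d∣a₁′ ⊛ d∣a₂′
  ⊛ inverse₃ ⊛ inverse₁ ⊛ inverse₂
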